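{- For any problem instance $\mathcal{P}(\theta,\rho,r,v)$ of the conical perimeter defense problem such that $$v\le\min\Big\{\frac{r}{\theta(\rho+r)},\ \frac{1-\rho}{\theta(2-3r+\rho)}\Big\},$$ with the choice of any $$x_C\in\Big[\frac{\rho-r}{1-2\theta v},\ \min\Big\{\rho+r,\frac{1-r}{1+v\theta}\Big\}\Big],$$ the Conical Compare and Capture (ConCaC) algorithm with radius $x_C$ is $2$-competitive.
   Context: Points of the plane are given in polar coordinates (radius, angle), the angle being measured from the symmetry axis of the environment, positive to the right. The environment is $\mathcal{E}(\theta)=\{(y,\alpha): 0<y\le 1,\ -\theta\le\alpha\le\theta\}$ and it contains the region (the perimeter) $\mathcal{R}(\rho,\theta)=\{(z,\alpha): 0<z\le\rho<1,\ -\theta\le\alpha\le\theta\}$. A problem instance $\mathcal{P}(\theta,\rho,r,v)$ is given by parameters $0<\theta\le\pi$, $0<\rho<1$, intruder speed $0<v<1$, and capture radius $0<r<\rho$. Intruders are released over time on the circumference $y=1$ and move radially inward toward the origin with fixed speed $v$. A single vehicle moves in the environment with maximum speed $1$ (first-order integrator). The capture circle is the (closed) circle of radius $r$ centered at the vehicle. An intruder is captured, and removed, as soon as it lies within or on the capture circle; it is lost if it reaches the perimeter (radius $\rho$) without being captured. An input instance $\mathcal{I}$ specifies, up to a final time $T$, the release times $t\le T$, the number $N(t)$ of intruders released at time $t$, and their release locations $(1,\alpha_1),\dots,(1,\alpha_{N(t)})$ with $\alpha_l\in[-\theta,\theta]$. An online algorithm assigns to the vehicle at each time a velocity of magnitude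 at most $1$ as a function only of the part of $\mathcal{I}$ revealed so far; an offline algorithm knows the entire $\mathcal{I}$ in advance. $A(\mathcal{I})$ is the number of intruders captured by algorithm $A$ on $\mathcal{I}$, and $\mathcal{O}$ is the optimal offline algorithm, maximizing the number captured. $A$ is $c$-competitive for $\mathcal{P}$ (for a constant $c\ge1$) if $\sup_{\mathcal{I}}\mathcal{O}(\mathcal{I})/A(\mathcal{I})\le c$, i.e. $\mathcal{O}(\mathcal{I})\le c\,A(\mathcal{I})$ for all input instances $\mathcal{I}$. ConCaC with radius $x_C$ (fixed throughout): time $0$ is the time when the first intruder arrives. The vehicle starts at $(x_C,0)$ and waits there for $1-\min\{1,x_C+r+2\theta v x_C\}$ units of time; then it begins epoch $k=1$. At the start of each epoch $k\ge1$ the vehicle is at $(x_C,0)$ and compares the numbers $|S^k_{\mathrm{left}}|$ and $|S^k_{\mathrm{right}}|$ of intruders currently located in the sets $$S^k_{\mathrm{right}}=\{(y,\beta):\ \rho+\beta x_C v<y\le\min\{1,\,x_C+r+(2\theta-\beta)v x_C\},\ \beta\in[0,\theta]\},$$ $$S^k_{\mathrm{left}}=\{(y,\beta):\ \rho-\beta x_C v<y\le\min\{1,\,x_C+r+(2\theta+\beta)v x_C\},\ \beta\in[-\theta,0)\}.$$ If $|S^k_{\mathrm{left}}|<|S^k_{\mathrm{right}}|$, it moves at unit speed along the circular arc of radius $x_C$ centered at the origin from $(x_C,0)$ to $(x_C,\theta)$ and back along the same arc to $(x_C,0)$; otherwise it does the same with $(x_C,-\theta)$ in place of $(x_C,\theta)$.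 Intruders are captured along the way. The epoch ends on return to $(x_C,0)$ and the next epoch begins. -}

module Defs where

open import Level using (0ℓ)
open import Axiom.ExcludedMiddle using (ExcludedMiddle)
open import Algebra.Bundles using (CommutativeRing; Semiring)
open import Algebra.Structures using (IsCommutativeRing)
import Algebra.Construct.NaturalChoice.Min as Min
import Algebra.Definitions.RawSemiring as RawSemiringOps
open import Data.List.Base using (List; []; length; filter)
open import Data.List.Relation.Unary.All using (All)
open import Data.List.Relation.Unary.Any using (Any)
open import Data.Nat.Base as ℕ using (ℕ; zero; suc; _!)
import Data.Nat.Properties as ℕ
open import Data.Product.Base using (∃; _×_; _,_; proj₁)
open import Data.Sum.Base using (_⊎_)
open import Relation.Binary.Bundles using (TotalOrder)
open import Relation.Binary.PropositionalEquality.Core using (_≡_; _≢_)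
open import Relation.Binary.Structures using (IsTotalOrder)
import Relation.Binary.Construct.NonStrictToStrict as ToStrict
open import Relation.Nullary using (¬_; yes; no)

-- The real numbers, characterised (up to unique isomorphism) as a complete
-- ordered field.  The inverse is total; x ⁻¹ is unspecified at 0#.

record CompleteOrderedField : Set₁ where
  infix  9 _⁻¹
  infix  8 -_
  infixl 7 _*_
  infixl 6 _+_
  infix  4 _≤_
  field
    Carrier           : Set
    _≤_               : Carrier → Carrier → Set
    _+_ _*_           : Carrier → Carrier → Carrier
    -_ _⁻¹            : Carrier → Carrier
    0# 1#             : Carrier
    isCommutativeRing : IsCommutativeRing _≡_ _+_ _*_ -_ 0# 1#
    0≢1               : 0# ≢ 1#
    ⁻¹-inverse        : ∀ x → x ≢ 0# → x * x ⁻¹ ≡ 1#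
    isTotalOrder      : IsTotalOrder _≡_ _≤_
    +-monoˡ-≤         : ∀ z {x y} → x ≤ y → x + z ≤ y + z
    *-nonNegative     : ∀ {x y} → 0# ≤ x → 0# ≤ y → 0# ≤ x * y
    supremum          : (P : Carrier → Set) → ∃ P →
                        (∃ λ b → ∀ x → P x → x ≤ b) →
                        ∃ λ s → (∀ x → P x → x ≤ s) ×
                                (∀ b → (∀ x → P x → x ≤ b) → s ≤ b)

  commutativeRing : CommutativeRing 0ℓ 0ℓ
  commutativeRing = record { isCommutativeRing = isCommutativeRing }

  totalOrder : TotalOrder 0ℓ 0ℓ 0ℓ
  totalOrder = record { isTotalOrder = isTotalOrder }

  open CommutativeRing commutativeRing public using (_-_)
  open RawSemiringOps (Semiring.rawSemiring (CommutativeRing.semiring commutativeRing)) public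
    using (_^_) renaming (_×_ to _·_)
  open Min totalOrder public using (_⊓_)
  open ToStrict _≡_ _≤_ public using (_<_)

  infixl 7 _/_
  _/_ : Carrier → Carrier → Carrier
  x / y = x * y ⁻¹

  fromℕ : ℕ → Carrier
  fromℕ n = n · 1#

  2# 3# : Carrier
  2# = fromℕ 2
  3# = fromℕ 3

module Classical (em : ExcludedMiddle 0ℓ) where

  count : {A : Set} (P : A → Set) → List A → ℕ
  count P xs = length (filter (λ x → em {P x}) xs)

  -- The largest n ≤ b with P n, or 0 if there is none.
  greatest : (P : ℕ → Set) (b : ℕ) → ℕ
  greatest P zero = zero
  greatest P (suc b) with em {P (suc b)}
  ... | yes _ = suc b
  ... | no  _ = greatest P b

module Trigonometry (em : ExcludedMiddle 0ℓ) (ℜ : CompleteOrderedField) where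
  open CompleteOrderedField ℜ renaming (Carrier to ℝ)

  -- Definite description; the junk value 0# is never reached in the uses below.
  the : (ℝ → Set) → ℝ
  the P with em {∃ P}
  ... | yes (x , _) = x
  ... | no  _       = 0#

  _⟶_ : (ℕ → ℝ) → ℝ → Set
  s ⟶ l = ∀ ε → 0# < ε → ∃ λ N → ∀ n → N ℕ.≤ n →
            - ε < s n - l × s n - l < ε

  cosSum : ℝ → ℕ → ℝ
  cosSum x zero    = 0#
  cosSum x (suc n) =
    cosSum x n + (- 1#) ^ n * x ^ (2 ℕ.* n) / fromℕ ((2 ℕ.* n) !)

  cos : ℝ → ℝ
  cos x = the λ c → cosSum x ⟶ c

  -- π / 2 is the least positive zero of the cosine.
  π : ℝ
  π = 2# * the λ h → 0# < h × cos h ≡ 0# × (∀ t → 0# < t → t < h → cos t ≢ 0#)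

module PerimeterDefense (em : ExcludedMiddle 0ℓ) (ℜ : CompleteOrderedField) where
  open CompleteOrderedField ℜ renaming (Carrier to ℝ)
  open Classical em
  open Trigonometry em ℜ

  record Problem : Set where
    field
      θ ρ r v : ℝ
      0<θ : 0# < θ
      θ≤π : θ ≤ π
      0<ρ : 0# < ρ
      ρ<1 : ρ < 1#
      0<r : 0# < r
      r<ρ : r < ρ
      0<v : 0# < v
      v<1 : v < 1#

  -- A point of the plane in polar coordinates.
  record Point : Set where
    constructor polar
    field
      radius angle : ℝ

  open Point

  -- Squared Euclidean distance (law of cosines).  Comparing dist² with the
  -- square of a number is how distances are compared with its absolute value.
  dist² : Point → Point → ℝ
  dist² (polar a α) (polar b β) = a ^ 2 + b ^ 2 - 2# * a * b * cos (α - β)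

  -- Position as a function of time; only times t ≥ 0 are relevant.
  Trajectory : Set
  Trajectory = ℝ → Point

  record Intruder : Set where
    field
      release direction : ℝ

  open Intruder

  module Game (𝒫 : Problem) where
    open Problem 𝒫

    -- Simultaneous releases are repeated entries.  Time 0 is the time of the
    -- first release.
    record Instance : Set where
      field
        intruders  : List Intruder
        T          : ℝ
        times      : All (λ i → 0# ≤ release i × release i ≤ T) intruders
        directions : All (λ i → - θ ≤ direction i × direction i ≤ θ) intruders
        first      : intruders ≡ [] ⊎ Any (λ i → release i ≡ 0#) intruders

    open Instance

    InEnvironment : Point → Set
    InEnvironment p = (0# < radius p × radius p ≤ 1#) ×
                      (- θ ≤ angle p × angle p ≤ θ)

    -- Trajectories of a first-order integrator of maximum speed 1 are the
    -- 1-Lipschitz ones.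
    record Admissible (p : Trajectory) : Set where
      field
        inside : ∀ t → 0# ≤ t → InEnvironment (p t)
        speed  : ∀ s t → 0# ≤ s → 0# ≤ t → dist² (p s) (p t) ≤ (s - t) ^ 2

    -- Position at a time t ≥ release i, ignoring capture and loss.
    position : Intruder → ℝ → Point
    position i t = polar (1# - v * (t - release i)) (direction i)

    -- i lies within the capture circle at time t, having been released and not
    -- having passed the perimeter.  Contact at the very moment of reaching the
    -- perimeter counts as capture.
    Contact : Trajectory → Intruder → ℝ → Set
    Contact p i t = release i ≤ t × ρ ≤ radius (position i t) ×
                    dist² (p t) (position i t) ≤ r ^ 2

    CapturedBy : Trajectory → ℝ → Intruder → Set
    CapturedBy p t i = ∃ λ s → s ≤ t × Contact p i s

    Captured : Trajectory → Intruder → Set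
    Captured p i = ∃ λ s → Contact p i s

    captures : Instance → Trajectory → ℕ
    captures I p = count (Captured p) (intruders I)

    -- The number of intruders captured by the optimal offline algorithm.
    optimum : Instance → ℕ
    optimum I = greatest
      (λ n → ∃ λ p → Admissible p × captures I p ≡ n)
      (length (intruders I))

    Algorithm : Set
    Algorithm = Instance → Trajectory

    Competitive : ℝ → Algorithm → Set
    Competitive c A = ∀ I → fromℕ (optimum I) ≤ c * fromℕ (captures I (A I))

    module ConCaCDefinition (x-C : ℝ) where

      data Side : Set where
        left right : Side

      Sright : Point → Set
      Sright (polar y β) =
        (ρ + β * x-C * v < y × y ≤ 1# ⊓ (x-C + r + (2# * θ - β) * v * x-C)) ×
        (0# ≤ β × β ≤ θ)

      Sleft : Point → Set
      Sleft (polar y β) =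
        (ρ - β * x-C * v < y × y ≤ 1# ⊓ (x-C + r + (2# * θ + β) * v * x-C)) ×
        (- θ ≤ β × β < 0#)

      home : Point
      home = polar x-C 0#

      onArc : Side → ℝ → Point
      onArc right φ = polar x-C φ
      onArc left  φ = polar x-C (- φ)

      half : ℝ
      half = θ * x-C

      -- Position u time units into an epoch, 0 ≤ u ≤ 2 half: unit speed on the
      -- circle of radius x-C is angular speed 1 / x-C.
      excursion : Side → ℝ → Point
      excursion σ u with em {u ≤ half}
      ... | yes _ = onArc σ (u / x-C)
      ... | no  _ = onArc σ (2# * θ - u / x-C)

      -- Epochs are numbered from 0 here.
      start : ℕ → ℝ
      start k = 1# - 1# ⊓ (x-C + r + 2# * θ * v * x-C) + fromℕ k * (2# * half)

      -- i is present at time t: released and not captured.  (An intruder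
      -- in Sleft or Sright has radius > ρ, so it is not lost.)
      Present : Trajectory → ℝ → Intruder → Set
      Present p t i = release i ≤ t × ¬ CapturedBy p t i

      number : (Point → Set) → Instance → Trajectory → ℝ → ℕ
      number S I p t =
        count (λ i → Present p t i × S (position i t)) (intruders I)

      choose : Instance → Trajectory → ℝ → Side
      choose I p t with number Sleft I p t ℕ.<? number Sright I p t
      ... | yes _ = right
      ... | no  _ = left

      -- The behaviour up to time start k, after which the vehicle stays home.
      firstEpochs : Instance → ℕ → Trajectory
      firstEpochs I zero    t = home
      firstEpochs I (suc k) t with em {t ≤ start k} | em {t ≤ start (suc k)}
      ... | yes _ | _     = firstEpochs I k t
      ... | no  _ | no  _ = home
      ... | no  _ | yes _ =
        excursion (choose I (firstEpochs I k) (start k)) (t - start k)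

      -- The value at t does not depend on the choice of k with t ≤ start k;
      -- such k exists when 0 < x-C, as ℝ is Archimedean.
      ConCaC : Algorithm
      ConCaC I t with em {∃ λ k → t ≤ start k}
      ... | yes (k , _) = firstEpochs I k t
      ... | no  _       = home

    open ConCaCDefinition public using (ConCaC)

{-# OPTIONS --safe #-}
module Submission where

-- Consider an intruder on the side that the vehicle chooses in an epoch.
-- x-C ≤ ρ + r puts it within reach from outside when the vehicle first passes
-- below it, unless it is still farther out than x-C + r; in that case
-- (ρ - r) / (1 - 2 θ v) ≤ x-C keeps it outside the perimeter until the vehicle
-- passes again on its way back, when it is within reach.  So the whole chosen
-- side is captured.  The bounds on x-C also make the part of each ray that
-- belongs to Sleft or Sright at least as long as the way of an intruder in one
-- epoch, so every intruder takes part in some comparison.  An intruder that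
-- escapes is thus on the rejected side of some epoch, and the captures of that
-- epoch pay for it: at most as many intruders escape as are captured.

open import Level using (0ℓ)
open import Axiom.ExcludedMiddle using (ExcludedMiddle)
open import Defs

import Algebra.Construct.NaturalChoice.Min as Min
open import Algebra.Bundles using (CommutativeRing)
import Algebra.Properties.Ring as RingProperties
import Algebra.Properties.Semiring.Mult as Mult
import Algebra.Properties.Semiring.Mult.TCOptimised as Mult′
import Algebra.Solver.Ring as RingSolver
open import Algebra.Solver.Ring.AlmostCommutativeRing
  using (fromCommutativeRing; _-Raw-AlmostCommutative⟶_)
open import Data.Integer.Base as ℤ using (ℤ; +_; -[1+_]; _⊖_)
import Data.Integer.Properties as ℤ
open import Data.List.Base using ([]; _∷_; length)
open import Data.List.Relation.Unary.All as All using (All; []; _∷_)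
import Data.Maybe.Base as Maybe
open import Data.Nat.Base as ℕ using (ℕ; zero; suc; z≤n; s≤s)
import Data.Nat.Properties as ℕ
open import Data.Product.Base using (∃; _×_; _,_; proj₁; proj₂)
open import Data.Sum.Base using (_⊎_; inj₁; inj₂)
open import Function.Base using (_∘_)
open import Relation.Binary.Bundles using (TotalOrder)
import Relation.Binary.Construct.NonStrictToStrict as ToStrict
open import Relation.Binary.PropositionalEquality
  using (_≡_; _≢_; refl; sym; trans; cong; cong₂; subst; subst₂; module ≡-Reasoning)
open import Relation.Nullary using (¬_; yes; no; contradiction)
open import Relation.Nullary.Decidable using (dec⇒maybe)

-- A ring solver with integer coefficients over any commutative ring.

module IntegerCoefficients (R : CommutativeRing 0ℓ 0ℓ) where
  open CommutativeRing R
    renaming (sym to ≈-sym; refl to ≈-refl; trans to ≈-trans; reflexive to ≈-reflexive)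
  open RingProperties ring
  open Mult′ semiring using (1+×; ×-homo-+; ×1-homo-*) renaming (_×_ to _·_)
  open import Relation.Binary.Reasoning.Setoid setoid

  -- With the optimised multiples, ⟦ + 1 ⟧ is 1# itself and not 1# + 0#, so that
  -- the solver's constants match the constants of the goals.
  ⟦_⟧ : ℤ → Carrier
  ⟦ + n      ⟧ = n · 1#
  ⟦ -[1+ n ] ⟧ = - (suc n · 1#)

  ⟦⟧-neg : ∀ i → ⟦ ℤ.- i ⟧ ≈ - ⟦ i ⟧
  ⟦⟧-neg (+ zero)  = ≈-sym -0#≈0#
  ⟦⟧-neg (+ suc n) = ≈-refl
  ⟦⟧-neg -[1+ n ]  = ≈-sym (-‿involutive _)

  cancel-1# : ∀ x y → (1# + x) - (1# + y) ≈ x - y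
  cancel-1# x y = begin
    (1# + x) + - (1# + y)     ≈⟨ +-cong (+-comm 1# x) (≈-sym (-‿+-comm 1# y)) ⟩
    (x + 1#) + (- 1# + - y)   ≈⟨ +-assoc x 1# _ ⟩
    x + (1# + (- 1# + - y))   ≈⟨ +-congˡ (≈-sym (+-assoc 1# (- 1#) (- y))) ⟩
    x + ((1# + - 1#) + - y)   ≈⟨ +-congˡ (+-congʳ (-‿inverseʳ 1#)) ⟩
    x + (0# + - y)            ≈⟨ +-congˡ (+-identityˡ (- y)) ⟩
    x + - y                   ∎

  ⟦⟧-⊖ : ∀ m n → ⟦ m ⊖ n ⟧ ≈ m · 1# - n · 1#
  ⟦⟧-⊖ m       zero    = ≈-sym (≈-trans (+-congˡ -0#≈0#) (+-identityʳ _))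
  ⟦⟧-⊖ zero    (suc n) = ≈-sym (+-identityˡ _)
  ⟦⟧-⊖ (suc m) (suc n) = begin
    ⟦ suc m ⊖ suc n ⟧              ≡⟨ cong ⟦_⟧ (ℤ.[1+m]⊖[1+n]≡m⊖n m n) ⟩
    ⟦ m ⊖ n ⟧                      ≈⟨ ⟦⟧-⊖ m n ⟩
    m · 1# - n · 1#                ≈⟨ cancel-1# _ _ ⟨
    (1# + m · 1#) - (1# + n · 1#)  ≈⟨ +-cong (1+× m 1#) (-‿cong (1+× n 1#)) ⟨
    suc m · 1# - suc n · 1#        ∎

  ⟦⟧-+ : ∀ i j → ⟦ i ℤ.+ j ⟧ ≈ ⟦ i ⟧ + ⟦ j ⟧
  ⟦⟧-+ (+ m)    (+ n)    = ×-homo-+ 1# m n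
  ⟦⟧-+ (+ m)    -[1+ n ] = ⟦⟧-⊖ m (suc n)
  ⟦⟧-+ -[1+ m ] (+ n)    = ≈-trans (⟦⟧-⊖ n (suc m)) (+-comm _ _)
  ⟦⟧-+ -[1+ m ] -[1+ n ] = begin
    - (suc (suc (m ℕ.+ n)) · 1#)       ≡⟨ cong (λ k → - (suc k · 1#)) (ℕ.+-suc m n) ⟨
    - ((suc m ℕ.+ suc n) · 1#)         ≈⟨ -‿cong (×-homo-+ 1# (suc m) (suc n)) ⟩
    - (suc m · 1# + suc n · 1#)        ≈⟨ -‿+-comm _ _ ⟨
    - (suc m · 1#) + - (suc n · 1#)    ∎

  ⟦⟧-*-+ : ∀ m j → ⟦ + m ℤ.* j ⟧ ≈ ⟦ + m ⟧ * ⟦ j ⟧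
  ⟦⟧-*-+ m (+ n)    = ≈-trans (≈-reflexive (cong ⟦_⟧ (sym (ℤ.pos-* m n)))) (×1-homo-* m n)
  ⟦⟧-*-+ m -[1+ n ] = begin
    ⟦ + m ℤ.* (ℤ.- + suc n) ⟧    ≡⟨ cong ⟦_⟧ (ℤ.neg-distribʳ-* (+ m) (+ suc n)) ⟨
    ⟦ ℤ.- (+ m ℤ.* + suc n) ⟧    ≈⟨ ⟦⟧-neg (+ m ℤ.* + suc n) ⟩
    - ⟦ + m ℤ.* + suc n ⟧        ≈⟨ -‿cong (⟦⟧-*-+ m (+ suc n)) ⟩
    - (m · 1# * (suc n · 1#))    ≈⟨ -‿distribʳ-* _ _ ⟩
    m · 1# * - (suc n · 1#)      ∎

  ⟦⟧-* : ∀ i j → ⟦ i ℤ.* j ⟧ ≈ ⟦ i ⟧ * ⟦ j ⟧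
  ⟦⟧-* (+ m)    j = ⟦⟧-*-+ m j
  ⟦⟧-* -[1+ m ] j = begin
    ⟦ (ℤ.- + suc m) ℤ.* j ⟧   ≡⟨ cong ⟦_⟧ (ℤ.neg-distribˡ-* (+ suc m) j) ⟨
    ⟦ ℤ.- (+ suc m ℤ.* j) ⟧   ≈⟨ ⟦⟧-neg (+ suc m ℤ.* j) ⟩
    - ⟦ + suc m ℤ.* j ⟧       ≈⟨ -‿cong (⟦⟧-*-+ (suc m) j) ⟩
    - (suc m · 1# * ⟦ j ⟧)    ≈⟨ -‿distribˡ-* _ _ ⟩
    - (suc m · 1#) * ⟦ j ⟧    ∎

  morphism : ℤ.+-*-rawRing -Raw-AlmostCommutative⟶ fromCommutativeRing R
  morphism = record
    { ⟦_⟧    = ⟦_⟧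
    ; +-homo = ⟦⟧-+
    ; *-homo = ⟦⟧-*
    ; -‿homo = ⟦⟧-neg
    ; 0-homo = ≈-refl
    ; 1-homo = ≈-refl
    }

  open RingSolver ℤ.+-*-rawRing (fromCommutativeRing R) morphism
    (λ i j → Maybe.map (≈-reflexive ∘ cong ⟦_⟧) (dec⇒maybe (i ℤ.≟ j)))
    public using (Polynomial; solve; con; _:=_; _:+_; _:*_; _:-_; :-_; _:^_)

-- Ordered field arithmetic and the Archimedean property.

module OrderedField (em : ExcludedMiddle 0ℓ) (ℜ : CompleteOrderedField) where
  open CompleteOrderedField ℜ renaming (Carrier to ℝ)
  open CommutativeRing commutativeRing public using
    ( +-comm; +-identityˡ; +-identityʳ; -‿inverseʳ
    ; *-assoc; *-identityˡ; *-identityʳ; zeroˡ; zeroʳ )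
  open TotalOrder totalOrder public using (total) renaming
    (refl to ≤-refl; reflexive to ≤-reflexive; trans to ≤-trans; antisym to ≤-antisym)
  open Min totalOrder public using (⊓-glb; x⊓y≤x; x≤y⊓z⇒x≤y; x≤y⊓z⇒x≤z)
  open IntegerCoefficients commutativeRing public
    using (Polynomial; solve; con; _:=_; _:+_; _:*_; _:-_; :-_; _:^_)

  -- `2#` unfolds to `1# + (1# + 0#)`; `:2` copies this shape, so that solved equations match goals
  -- that contain `2#`.
  :0 :1 :2 : ∀ {n} → Polynomial n
  :0 = con (+ 0)
  :1 = con (+ 1)
  :2 = :1 :+ (:1 :+ :0)

  <⇒≤ : ∀ {x y} → x < y → x ≤ y
  <⇒≤ = proj₁

  <⇒≱ : ∀ {x y} → x < y → ¬ y ≤ x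
  <⇒≱ = ToStrict.<⇒≱ _≡_ _≤_ ≤-antisym

  ≰⇒> : ∀ {x y} → ¬ x ≤ y → y < x
  ≰⇒> = ToStrict.≰⇒> _≡_ _≤_ sym ≤-reflexive total

  <-≤-trans : ∀ {x y z} → x < y → y ≤ z → x < z
  <-≤-trans x<y y≤z = ≰⇒> λ z≤x → <⇒≱ x<y (≤-trans y≤z z≤x)

  ≤-or-> : ∀ x y → x ≤ y ⊎ y < x
  ≤-or-> x y with em {x ≤ y}
  ... | yes x≤y = inj₁ x≤y
  ... | no  x≰y = inj₂ (≰⇒> x≰y)

  +-mono-≤ : ∀ {w x y z} → w ≤ x → y ≤ z → w + y ≤ x + z
  +-mono-≤ {w} {x} {y} {z} w≤x y≤z = ≤-trans (+-monoˡ-≤ y w≤x)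
    (subst₂ _≤_ (+-comm y x) (+-comm z x) (+-monoˡ-≤ x y≤z))

  -- An inequality follows from any other with the same difference of sides;
  -- the equality of the two differences is left to the ring solver.
  ≤-via : ∀ {w x y z} → z - y ≡ x - w → w ≤ x → y ≤ z
  ≤-via {w} {x} {y} {z} eq w≤x = subst₂ _≤_
    (solve 2 (λ w y → w :+ (y :- w) := y) refl w y)
    (trans (solve 3 (λ w x y → x :+ (y :- w) := (x :- w) :+ y) refl w x y)
      (trans (cong (_+ y) (sym eq)) (solve 2 (λ y z → (z :- y) :+ y := z) refl y z)))
    (+-monoˡ-≤ (y - w) w≤x)

  <-via : ∀ {w x y z} → z - y ≡ x - w → w < x → y < z
  <-via {w} {x} {y} {z} eq w<x = ≰⇒> λ z≤y → <⇒≱ w<x (≤-via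
    (trans (solve 2 (λ w x → w :- x := :- (x :- w)) refl w x)
      (trans (cong -_ (sym eq)) (solve 2 (λ y z → :- (z :- y) := y :- z) refl y z))) z≤y)

  +-mono-<-≤ : ∀ {w x y z} → w < x → y ≤ z → w + y < x + z
  +-mono-<-≤ {w} {x} {y} {z} w<x y≤z = <-≤-trans
    (<-via (solve 3 (λ w x y → (x :+ y) :- (w :+ y) := x :- w) refl w x y) w<x)
    (+-mono-≤ ≤-refl y≤z)

  *-positive : ∀ {x y} → 0# < x → 0# < y → 0# < x * y
  *-positive {x} {y} 0<x 0<y = *-nonNegative (<⇒≤ 0<x) (<⇒≤ 0<y) , λ 0≡xy → proj₂ 0<y
    (sym (begin
      y               ≡⟨ *-identityˡ y ⟨
      1# * y          ≡⟨ cong (_* y) (⁻¹-inverse x (proj₂ 0<x ∘ sym)) ⟨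
      x * x ⁻¹ * y    ≡⟨ solve 3 (λ x i y → x :* i :* y := i :* (x :* y)) refl x (x ⁻¹) y ⟩
      x ⁻¹ * (x * y)  ≡⟨ cong (x ⁻¹ *_) 0≡xy ⟨
      x ⁻¹ * 0#       ≡⟨ zeroʳ (x ⁻¹) ⟩
      0#              ∎))
    where open ≡-Reasoning

  0<1 : 0# < 1#
  0<1 with total 0# 1#
  ... | inj₁ 0≤1 = 0≤1 , 0≢1
  -- If `1# ≤ 0#`, then `- 1#` is nonnegative, and so is its square `1#`.
  ... | inj₂ 1≤0 = ≤-via (solve 0 (:1 :- :0 := (:- :1) :* (:- :1) :- :0) refl)
    (*-nonNegative 0≤-1 0≤-1) , 0≢1
    where
    0≤-1 : 0# ≤ - 1#
    0≤-1 = ≤-via (solve 0 (:- :1 :- :0 := :0 :- :1) refl) 1≤0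

  module _ {x : ℝ} (0<x : 0# < x) where

    *-⁻¹ : x * x ⁻¹ ≡ 1#
    *-⁻¹ = ⁻¹-inverse x (proj₂ 0<x ∘ sym)

    ⁻¹-positive : 0# < x ⁻¹
    ⁻¹-positive = ≰⇒> λ x⁻¹≤0 → <⇒≱ 0<1 (≤-via
      (trans (cong (_-_ 0#) (sym *-⁻¹)) (solve 2 (λ x i → :0 :- x :* i := x :* (:0 :- i) :- :0) refl x (x ⁻¹)))
      (*-nonNegative (<⇒≤ 0<x) (≤-via (solve 1 (λ i → (:0 :- i) :- :0 := :0 :- i) refl (x ⁻¹)) x⁻¹≤0)))

    *-/-cancel : ∀ y → y * x / x ≡ y
    *-/-cancel y = trans (*-assoc y x (x ⁻¹)) (trans (cong (y *_) *-⁻¹) (*-identityʳ y))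

    /-*-cancel : ∀ y → y / x * x ≡ y
    /-*-cancel y = trans (solve 3 (λ x i y → y :* i :* x := y :* x :* i) refl x (x ⁻¹) y) (*-/-cancel y)

    *-monoʳ-≤ : ∀ {y z} → y ≤ z → y * x ≤ z * x
    *-monoʳ-≤ {y} {z} y≤z = ≤-via
      (solve 3 (λ x y z → z :* x :- y :* x := (z :- y) :* x :- :0) refl x y z)
      (*-nonNegative (≤-via (solve 2 (λ y z → (z :- y) :- :0 := z :- y) refl y z) y≤z) (<⇒≤ 0<x))

    y≤z/x⇒y*x≤z : ∀ {y z} → y ≤ z / x → y * x ≤ z
    y≤z/x⇒y*x≤z {y} {z} y≤z/x = subst (y * x ≤_) (/-*-cancel z) (*-monoʳ-≤ y≤z/x)

    y/x≤z⇒y≤z*x : ∀ {y z} → y / x ≤ z → y ≤ z * x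
    y/x≤z⇒y≤z*x {y} {z} y/x≤z = subst (_≤ z * x) (/-*-cancel y) (*-monoʳ-≤ y/x≤z)

  0≤-diff : ∀ {x y} → x ≤ y → 0# ≤ y - x
  0≤-diff {x} {y} = ≤-via (solve 2 (λ x y → (y :- x) :- :0 := y :- x) refl x y)

  0<-diff : ∀ {x y} → x < y → 0# < y - x
  0<-diff {x} {y} = <-via (solve 2 (λ x y → (y :- x) :- :0 := y :- x) refl x y)

  fromℕ-mono : ∀ {m n} → m ℕ.≤ n → fromℕ m ≤ fromℕ n
  fromℕ-mono {n = zero}  z≤n       = ≤-refl
  fromℕ-mono {n = suc n} z≤n       = subst (_≤ fromℕ (suc n)) (+-identityˡ 0#)
    (+-mono-≤ (<⇒≤ 0<1) (fromℕ-mono {n = n} z≤n))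
  fromℕ-mono             (s≤s m≤n) = +-mono-≤ ≤-refl (fromℕ-mono m≤n)

  fromℕ-+ : ∀ m n → fromℕ (m ℕ.+ n) ≡ fromℕ m + fromℕ n
  fromℕ-+ = Mult.×-homo-+ (CommutativeRing.semiring commutativeRing) 1#

  -- If all `a + fromℕ k * d` stayed below `t`, they would have a supremum `s`. The successor of
  -- each is again one of them, so `s - d` would be a smaller upper bound.
  archimedean : ∀ {d} → 0# < d → ∀ a t → ∃ λ k → t ≤ a + fromℕ k * d
  archimedean {d} 0<d a t with em {∃ λ k → t ≤ a + fromℕ k * d}
  ... | yes p = p
  ... | no ¬p = contradiction s≤s-d (<⇒≱
    (<-via (solve 2 (λ s d → s :- (s :- d) := d :- :0) refl s d) 0<d))
    where
    Multiple : ℝ → Set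
    Multiple x = ∃ λ k → x ≡ a + fromℕ k * d

    sup : ∃ λ s → (∀ x → Multiple x → x ≤ s) × (∀ b → (∀ x → Multiple x → x ≤ b) → s ≤ b)
    sup = supremum Multiple (_ , 0 , refl)
      (t , λ { x (k , refl) → <⇒≤ (≰⇒> λ t≤ → ¬p (k , t≤)) })

    s : ℝ
    s = proj₁ sup

    s≤s-d : s ≤ s - d
    s≤s-d = proj₂ (proj₂ sup) (s - d) λ { x (k , refl) →
      ≤-via (solve 4 (λ a d n s → (s :- d) :- (a :+ n :* d) := s :- (a :+ (:1 :+ n) :* d)) refl a d (fromℕ k) s)
        (proj₁ (proj₂ sup) _ (suc k , refl)) }

-- The value of the cosine series at zero.

module CosineAtZero (em : ExcludedMiddle 0ℓ) (ℜ : CompleteOrderedField) where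
  open CompleteOrderedField ℜ renaming (Carrier to ℝ)
  open OrderedField em ℜ
  open Trigonometry em ℜ

  -- Constancy starts at index 1 because `cosSum 0# 0` is the empty sum.
  ⟶-eventually-constant : ∀ {s c} → (∀ n → s (suc n) ≡ c) → s ⟶ c
  ⟶-eventually-constant {s} {c} const ε 0<ε = 1 , λ { (suc n) _ →
    subst (λ x → - ε < x - c × x - c < ε) (sym (const n))
      ( <-via (solve 2 (λ c e → (c :- c) :- (:- e) := e :- :0) refl c ε) 0<ε
      , <-via (solve 2 (λ c e → e :- (c :- c) := e :- :0) refl c ε) 0<ε ) }

  -- `the` returns some limit, so uniqueness is needed to identify it. A nonzero gap between `l` and
  -- `c`, taken as `ε`, refutes convergence.
  limit-of-eventually-constant : ∀ {s c l} → (∀ n → s (suc n) ≡ c) → s ⟶ l → l ≡ c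
  limit-of-eventually-constant {s} {c} {l} const s⟶l = ≤-antisym l≤c c≤l
    where
    near : ∀ ε → 0# < ε → - ε < c - l × c - l < ε
    near ε 0<ε with s⟶l ε 0<ε
    ... | N , close = subst (λ x → - ε < x - l × x - l < ε) (const N) (close (suc N) (ℕ.n≤1+n N))

    l≤c : l ≤ c
    l≤c with ≤-or-> l c
    ... | inj₁ p   = p
    ... | inj₂ c<l = contradiction
      (≤-reflexive (solve 2 (λ c l → c :- l := :- (l :- c)) refl c l))
      (<⇒≱ (proj₁ (near (l - c) (0<-diff c<l))))

    c≤l : c ≤ l
    c≤l with ≤-or-> c l
    ... | inj₁ p   = p
    ... | inj₂ l<c = contradiction ≤-refl (<⇒≱ (proj₂ (near (c - l) (0<-diff l<c))))

  -- `1# + 0#` is what the factorial in the first term of the cosine series unfolds to.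
  1⁻¹ : (1# + 0#) ⁻¹ ≡ 1#
  1⁻¹ = trans (sym (*-identityˡ _))
    (trans (cong (_* (1# + 0#) ⁻¹) (sym (+-identityʳ 1#)))
      (*-⁻¹ (subst (0# <_) (sym (+-identityʳ 1#)) 0<1)))

  cosSum-0 : ∀ n → cosSum 0# (suc n) ≡ 1#
  cosSum-0 zero    = trans (cong (λ x → 0# + 1# * 1# * x) 1⁻¹)
    (solve 0 (:0 :+ :1 :* :1 :* :1 := :1) refl)
  cosSum-0 (suc n) = trans (cong₂ _+_ (cosSum-0 n)
      (solve 3 (λ x y z → x :* (:0 :* y) :* z := :0) refl _ _ _))
    (+-identityʳ 1#)

  cos-0 : cos 0# ≡ 1#
  cos-0 with em {∃ λ c → cosSum 0# ⟶ c}
  ... | yes (c , lim) = limit-of-eventually-constant cosSum-0 lim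
  ... | no  ¬∃        = contradiction (1# , ⟶-eventually-constant cosSum-0) ¬∃

-- Counting by classical predicates.

module Counting (em : ExcludedMiddle 0ℓ) where
  open Classical em

  private variable
    A : Set
    P Q R : A → Set

  count-mono : (∀ x → P x → Q x) → ∀ xs → count P xs ℕ.≤ count Q xs
  count-mono P⊆Q [] = z≤n
  count-mono {P = P} {Q = Q} P⊆Q (x ∷ xs) with em {P x} | em {Q x}
  ... | yes _ | yes _  = s≤s (count-mono P⊆Q xs)
  ... | yes p | no  ¬q = contradiction (P⊆Q x p) ¬q
  ... | no  _ | yes _  = ℕ.m≤n⇒m≤1+n (count-mono P⊆Q xs)
  ... | no  _ | no  _  = count-mono P⊆Q xs

  count-cover : (∀ x → R x → P x ⊎ Q x) → ∀ xs → count R xs ℕ.≤ count P xs ℕ.+ count Q xs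
  count-cover cover [] = z≤n
  count-cover {R = R} {P = P} {Q = Q} cover (x ∷ xs)
    with ih ← count-cover cover xs | em {R x} | em {P x} | em {Q x}
  ... | yes _ | yes _  | yes _  = s≤s (ℕ.≤-trans ih (ℕ.+-monoʳ-≤ _ (ℕ.n≤1+n _)))
  ... | yes _ | yes _  | no  _  = s≤s ih
  ... | yes _ | no  _  | yes _  = ℕ.≤-trans (s≤s ih) (ℕ.≤-reflexive (sym (ℕ.+-suc _ _)))
  ... | yes r | no  ¬p | no  ¬q = contradiction (cover x r) λ { (inj₁ p) → ¬p p ; (inj₂ q) → ¬q q }
  ... | no  _ | yes _  | yes _  = ℕ.≤-trans ih (ℕ.+-mono-≤ (ℕ.n≤1+n _) (ℕ.n≤1+n _))
  ... | no  _ | yes _  | no  _  = ℕ.m≤n⇒m≤1+n ih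
  ... | no  _ | no  _  | yes _  = ℕ.≤-trans ih (ℕ.+-monoʳ-≤ _ (ℕ.n≤1+n _))
  ... | no  _ | no  _  | no  _  = ih

  count-disjoint : (∀ x → P x → R x) → (∀ x → Q x → R x) → (∀ x → P x → ¬ Q x) →
                   ∀ xs → count P xs ℕ.+ count Q xs ℕ.≤ count R xs
  count-disjoint P⊆R Q⊆R P∩Q [] = z≤n
  count-disjoint {P = P} {R = R} {Q = Q} P⊆R Q⊆R P∩Q (x ∷ xs)
    with ih ← count-disjoint P⊆R Q⊆R P∩Q xs | em {P x} | em {Q x} | em {R x}
  ... | yes p | yes q | _      = contradiction q (P∩Q x p)
  ... | yes p | no  _ | no  ¬r = contradiction (P⊆R x p) ¬r
  ... | no  _ | yes q | no  ¬r = contradiction (Q⊆R x q) ¬r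
  ... | yes _ | no  _ | yes _  = s≤s ih
  ... | no  _ | yes _ | yes _  = ℕ.≤-trans (ℕ.≤-reflexive (ℕ.+-suc _ _)) (s≤s ih)
  ... | no  _ | no  _ | yes _  = ℕ.m≤n⇒m≤1+n ih
  ... | no  _ | no  _ | no  _  = ih

  count-all : ∀ {xs} → All P xs → length xs ≡ count P xs
  count-all []       = refl
  count-all {P = P} (_∷_ {x} p ps) with em {P x}
  ... | yes _ = cong suc (count-all ps)
  ... | no ¬p = contradiction p ¬p

  greatest≤ : (P : ℕ → Set) → ∀ b → greatest P b ℕ.≤ b
  greatest≤ P zero    = z≤n
  greatest≤ P (suc b) with em {P (suc b)}
  ... | yes _ = ℕ.≤-refl
  ... | no  _ = ℕ.m≤n⇒m≤1+n (greatest≤ P b)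

  -- Descending from `k` as long as `P` holds ends at 0 or just above a failure of `P`.
  first-occurrence : (P : ℕ → Set) → ∀ k → P k → P 0 ⊎ ∃ λ j → ¬ P j × P (suc j)
  first-occurrence P zero    p = inj₁ p
  first-occurrence P (suc k) p with em {P k}
  ... | yes q = first-occurrence P k q
  ... | no ¬q = inj₂ (k , ¬q , p)

-- The two sides of the environment and the epoch times.

module ConCaCAnalysis (em : ExcludedMiddle 0ℓ) (ℜ : CompleteOrderedField)
  (𝒫 : PerimeterDefense.Problem em ℜ) (X : CompleteOrderedField.Carrier ℜ) where
  open CompleteOrderedField ℜ renaming (Carrier to ℝ)
  open OrderedField em ℜ
  open CosineAtZero em ℜ using (cos-0)
  open Counting em
  open Classical em
  open Trigonometry em ℜ using (cos)
  open PerimeterDefense em ℜ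
  open Problem 𝒫
  open Game 𝒫 hiding (ConCaC)
  open ConCaCDefinition X
  open Point
  open Intruder
  open Instance

  Region : Side → Point → Set
  Region right = Sright
  Region left  = Sleft

  opposite : Side → Side
  opposite right = left
  opposite left  = right

  same-or-opposite : ∀ σ τ → τ ≡ σ ⊎ τ ≡ opposite σ
  same-or-opposite right right = inj₁ refl
  same-or-opposite right left  = inj₂ refl
  same-or-opposite left  right = inj₂ refl
  same-or-opposite left  left  = inj₁ refl

  -- With `φ` the angular distance from the axis, `Sright` and `Sleft` impose the same radial
  -- condition, so both sides are treated at once. The vehicle passes angle `φ` at times `φ * X` and
  -- `(2# * θ - φ) * X` of an epoch: the lower edge keeps the intruder outside the perimeter at the
  -- first pass, and the upper edge brings it within `X + r` by the second.
  Band : ℝ → ℝ → Set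
  Band φ y = ρ + φ * X * v < y × y ≤ 1# ⊓ (X + r + (2# * θ - φ) * v * X)

  reflect-lower : ∀ β → ρ - β * X * v ≡ ρ + - β * X * v
  reflect-lower β = solve 4 (λ ρ β x v → ρ :- β :* x :* v := ρ :+ (:- β) :* x :* v) refl ρ β X v

  reflect-upper : ∀ β → 1# ⊓ (X + r + (2# * θ + β) * v * X) ≡ 1# ⊓ (X + r + (2# * θ - - β) * v * X)
  reflect-upper β = cong (1# ⊓_) (solve 5
    (λ x r θ β v → x :+ r :+ (:2 :* θ :+ β) :* v :* x := x :+ r :+ (:2 :* θ :- (:- β)) :* v :* x)
    refl X r θ β v)

  region⇒band : ∀ σ {y β} → Region σ (polar y β) →
                ∃ λ φ → 0# ≤ φ × φ ≤ θ × onArc σ φ ≡ polar X β × Band φ y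
  region⇒band right {y} {β} (band , 0≤β , β≤θ) = β , 0≤β , β≤θ , refl , band
  region⇒band left  {y} {β} ((lower , upper) , -θ≤β , β<0) =
    - β ,
    ≤-via (solve 1 (λ β → (:- β) :- :0 := :0 :- β) refl β) (<⇒≤ β<0) ,
    ≤-via (solve 2 (λ β θ → θ :- (:- β) := β :- (:- θ)) refl β θ) -θ≤β ,
    cong (polar X) (solve 1 (λ β → :- (:- β) := β) refl β) ,
    subst (_< y) (reflect-lower β) lower ,
    subst (y ≤_) (reflect-upper β) upper

  -- `φ` is fixed before `y`: the direction never changes, while the epoch at which the radius is
  -- examined is found only later.
  band⇒region : ∀ {β} → - θ ≤ β → β ≤ θ →
                ∃ λ φ → 0# ≤ φ × φ ≤ θ × (∀ {y} → Band φ y → ∃ λ σ → Region σ (polar y β))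
  band⇒region {β} -θ≤β β≤θ with ≤-or-> 0# β
  ... | inj₁ 0≤β = β , 0≤β , β≤θ , λ band → right , band , 0≤β , β≤θ
  ... | inj₂ β<0 =
    - β ,
    ≤-via (solve 1 (λ β → (:- β) :- :0 := :0 :- β) refl β) (<⇒≤ β<0) ,
    ≤-via (solve 2 (λ β θ → θ :- (:- β) := β :- (:- θ)) refl β θ) -θ≤β ,
    λ {y} (lower , upper) → left ,
      (subst (_< y) (sym (reflect-lower β)) lower , subst (y ≤_) (sym (reflect-upper β)) upper) ,
      -θ≤β , β<0

  radius-later : ∀ i t u → radius (position i (t + u)) ≡ radius (position i t) - v * u
  radius-later i t u = solve 4
    (λ v t u τ → :1 :- v :* (t :+ u :- τ) := :1 :- v :* (t :- τ) :- v :* u) refl v t u (release i)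

  start-suc : ∀ k → start (suc k) ≡ start k + 2# * half
  start-suc k = solve 3 (λ a n d → a :+ (:1 :+ n) :* d := a :+ n :* d :+ d) refl _ (fromℕ k) (2# * half)

  start-zero : start 0 ≡ 1# - 1# ⊓ (X + r + 2# * θ * v * X)
  start-zero = solve 2 (λ a d → a :+ :0 :* d := a) refl _ (2# * half)

  -- Where the vehicle is during each epoch.

  module Trajectories (0<X : 0# < X) where

    0<2half : 0# < 2# * half
    0<2half = *-positive (subst (0# <_) (solve 0 (:1 :+ :1 := :2) refl)
        (<-≤-trans 0<1 (≤-via (solve 0 ((:1 :+ :1) :- :1 := :1 :- :0) refl) (<⇒≤ 0<1))))
      (*-positive 0<θ 0<X)

    start-mono : ∀ k → start k ≤ start (suc k)
    start-mono k = subst (start k ≤_) (sym (start-suc k))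
      (≤-via (solve 2 (λ s d → s :+ d :- s := d :- :0) refl (start k) (2# * half)) (<⇒≤ 0<2half))

    excursion-out : ∀ σ {φ} → φ ≤ θ → excursion σ (φ * X) ≡ onArc σ φ
    excursion-out σ {φ} φ≤θ with em {φ * X ≤ half}
    ... | yes _ = cong (onArc σ) (*-/-cancel 0<X φ)
    ... | no ¬p = contradiction (*-monoʳ-≤ 0<X φ≤θ) ¬p

    excursion-back : ∀ σ {φ} → φ ≤ θ → excursion σ ((2# * θ - φ) * X) ≡ onArc σ φ
    excursion-back σ {φ} φ≤θ with em {(2# * θ - φ) * X ≤ half}
    ... | no _  = cong (onArc σ) (trans (cong (_-_ (2# * θ)) (*-/-cancel 0<X (2# * θ - φ)))
      (solve 2 (λ θ φ → :2 :* θ :- (:2 :* θ :- φ) := φ) refl θ φ))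
    -- A return pass no later than `half` can only be the turning point `φ ≡ θ`, where the outward
    -- formula gives the same position.
    ... | yes p = cong (onArc σ) (trans (*-/-cancel 0<X (2# * θ - φ))
      (trans (cong (λ x → 2# * θ - x) φ≡θ)
        (trans (solve 1 (λ θ → :2 :* θ :- θ := θ) refl θ) (sym φ≡θ))))
      where
      θ≤φ : θ ≤ φ
      θ≤φ with ≤-or-> θ φ
      ... | inj₁ q   = q
      ... | inj₂ φ<θ = contradiction p (<⇒≱ (<-via
        (solve 3 (λ θ φ x → (:2 :* θ :- φ) :* x :- θ :* x := (θ :- φ) :* x :- :0) refl θ φ X)
        (*-positive (0<-diff φ<θ) 0<X)))

      φ≡θ : φ ≡ θ
      φ≡θ = ≤-antisym φ≤θ θ≤φ

    onArc-0 : ∀ σ → onArc σ 0# ≡ home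
    onArc-0 right = refl
    onArc-0 left  = cong (polar X) (solve 0 (:- :0 := :0) refl)

    excursion-start : ∀ σ → excursion σ 0# ≡ home
    excursion-start σ = trans (cong (excursion σ) (sym (zeroˡ X)))
      (trans (excursion-out σ (<⇒≤ 0<θ)) (onArc-0 σ))

    excursion-end : ∀ σ → excursion σ (2# * half) ≡ home
    excursion-end σ = trans
      (cong (excursion σ) (solve 2 (λ θ x → :2 :* (θ :* x) := (:2 :* θ :- :0) :* x) refl θ X))
      (trans (excursion-back σ (<⇒≤ 0<θ)) (onArc-0 σ))

    module _ (I : Instance) where

      chosen : ℕ → Side
      chosen k = choose I (firstEpochs I k) (start k)

      firstEpochs-early : ∀ k {t} → t ≤ start k → firstEpochs I (suc k) t ≡ firstEpochs I k t
      firstEpochs-early k {t} t≤ with em {t ≤ start k} | em {t ≤ start (suc k)}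
      ... | yes _ | _ = refl
      ... | no ¬p | _ = contradiction t≤ ¬p

      firstEpochs-epoch : ∀ k {t} → start k < t → t ≤ start (suc k) →
                          firstEpochs I (suc k) t ≡ excursion (chosen k) (t - start k)
      firstEpochs-epoch k {t} <t t≤ with em {t ≤ start k} | em {t ≤ start (suc k)}
      ... | yes p | _     = contradiction p (<⇒≱ <t)
      ... | no _  | yes _ = refl
      ... | no _  | no ¬p = contradiction t≤ ¬p

      start-later : ∀ j k {t} → t ≤ start k → t ≤ start (j ℕ.+ k)
      start-later zero    k t≤ = t≤
      start-later (suc j) k t≤ = ≤-trans (start-later j k t≤) (start-mono (j ℕ.+ k))

      firstEpochs-stable : ∀ j k {t} → t ≤ start k → firstEpochs I (j ℕ.+ k) t ≡ firstEpochs I k t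
      firstEpochs-stable zero    k t≤ = refl
      firstEpochs-stable (suc j) k t≤ =
        trans (firstEpochs-early (j ℕ.+ k) (start-later j k t≤)) (firstEpochs-stable j k t≤)

      -- The index `m` supplied by `em` is arbitrary; the prefixes for `m` and `k` are compared
      -- through the one for `k + m`.
      ConCaC-firstEpochs : ∀ k {t} → t ≤ start k → ConCaC I t ≡ firstEpochs I k t
      ConCaC-firstEpochs k {t} t≤ with em {∃ λ m → t ≤ start m}
      ... | no ¬p        = contradiction (k , t≤) ¬p
      ... | yes (m , t≤′) = trans (sym (firstEpochs-stable k m t≤′))
        (trans (cong (λ n → firstEpochs I n t) (ℕ.+-comm k m)) (firstEpochs-stable m k t≤))

      firstEpochs-home : ∀ k → firstEpochs I k (start k) ≡ home
      firstEpochs-home zero    = refl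
      firstEpochs-home (suc k) = trans
        (firstEpochs-epoch k (subst (start k <_) (sym (start-suc k))
          (<-via (solve 2 (λ s d → s :+ d :- s := d :- :0) refl (start k) (2# * half)) 0<2half)) ≤-refl)
        (trans (cong (excursion (chosen k)) (trans (cong (_- start k) (start-suc k))
            (solve 2 (λ s d → s :+ d :- s := d) refl (start k) (2# * half))))
          (excursion-end (chosen k)))

      ConCaC-epoch : ∀ k {u} → 0# ≤ u → u ≤ 2# * half → ConCaC I (start k + u) ≡ excursion (chosen k) u
      ConCaC-epoch k {u} 0≤u u≤ with ≤-or-> u 0#
      -- `firstEpochs` assigns the instant `start k` itself to what precedes the epoch; the vehicle
      -- is at `home` under either reading.
      ... | inj₁ u≤0 = subst (λ u → ConCaC I (start k + u) ≡ excursion (chosen k) u) (≤-antisym 0≤u u≤0)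
        (trans (cong (ConCaC I) (+-identityʳ (start k)))
          (trans (ConCaC-firstEpochs k ≤-refl)
            (trans (firstEpochs-home k) (sym (excursion-start (chosen k))))))
      ... | inj₂ 0<u = trans (ConCaC-firstEpochs (suc k) ≤end)
        (trans (firstEpochs-epoch k (<-via (solve 2 (λ s u → s :+ u :- s := u :- :0) refl (start k) u) 0<u) ≤end)
          (cong (excursion (chosen k)) (solve 2 (λ s u → s :+ u :- s := u) refl (start k) u)))
        where
        ≤end : start k + u ≤ start (suc k)
        ≤end = subst (start k + u ≤_) (sym (start-suc k)) (+-mono-≤ ≤-refl u≤)

      -- `choose` judges presence along `firstEpochs I k`, whereas captures are counted along
      -- `ConCaC I`; the two paths agree up to `start k`.
      CapturedBy-firstEpochs : ∀ k i → CapturedBy (firstEpochs I k) (start k) i →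
                               CapturedBy (ConCaC I) (start k) i
      CapturedBy-firstEpochs k i (s , s≤ , τ≤s , ρ≤ , close) = s , s≤ , τ≤s , ρ≤ ,
        subst (λ q → dist² q (position i s) ≤ r ^ 2) (sym (ConCaC-firstEpochs k s≤)) close

      CapturedBy-ConCaC : ∀ k i → CapturedBy (ConCaC I) (start k) i →
                          CapturedBy (firstEpochs I k) (start k) i
      CapturedBy-ConCaC k i (s , s≤ , τ≤s , ρ≤ , close) = s , s≤ , τ≤s , ρ≤ ,
        subst (λ q → dist² q (position i s) ≤ r ^ 2) (ConCaC-firstEpochs k s≤) close

  CapturedBy-mono : ∀ {p s t} i → s ≤ t → CapturedBy p s i → CapturedBy p t i
  CapturedBy-mono i s≤t (u , u≤s , c) = u , ≤-trans u≤s s≤t , c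

  -- Capture of the whole chosen side.

  module Guarantee
    (0<X : 0# < X)
    (ρ-r≤ : ρ - r ≤ X * (1# - 2# * θ * v))
    (X≤ρ+r : X ≤ ρ + r)
    (≤1-r : X * (1# + v * θ) ≤ 1# - r)
    where
    open Trajectories 0<X

    0<Xv : 0# < X * v
    0<Xv = *-positive 0<X 0<v

    -- On the intruder's own ray the law of cosines reduces to `(X - y) ^ 2`, and
    -- `r ^ 2 - (X - y) ^ 2` factors as `(X + r - y) * (r - (X - y))`. The second factor is
    -- nonnegative because `X ≤ ρ + r ≤ y + r`.
    contact : ∀ p i s → release i ≤ s → ρ ≤ radius (position i s) → radius (position i s) ≤ X + r →
              p s ≡ polar X (direction i) → Contact p i s
    contact p i s τ≤s ρ≤y y≤ at = τ≤s , ρ≤y ,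
      subst (λ q → dist² q (position i s) ≤ r ^ 2) (sym at)
        (subst (λ c → X ^ 2 + y ^ 2 - 2# * X * y * c ≤ r ^ 2) (sym cos-self)
          (≤-via (solve 3 (λ x y r → r :^ 2 :- (x :^ 2 :+ y :^ 2 :- :2 :* x :* y :* :1)
                                  := (x :+ r :- y) :* (r :- (x :- y)) :- :0) refl X y r)
            (*-nonNegative (0≤-diff y≤) (≤-via
              (solve 4 (λ x y r ρ → (r :- (x :- y)) :- :0 := ((ρ :+ r) :+ y) :- (x :+ ρ)) refl X y r ρ)
              (+-mono-≤ X≤ρ+r ρ≤y)))))
      where
      y = radius (position i s)

      cos-self : cos (direction i - direction i) ≡ 1#
      cos-self = trans (cong cos (-‿inverseʳ (direction i))) cos-0

    capture : ∀ I k i → release i ≤ start k → Region (chosen I k) (position i (start k)) →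
              CapturedBy (ConCaC I) (start (suc k)) i
    capture I k i τ≤ region with region⇒band (chosen I k) region
    ... | φ , 0≤φ , φ≤θ , arc , lower , upper =
      decide (≤-or-> (radius (position i (start k + φ * X))) (X + r))
      where
      y = radius (position i (start k))
      back = (2# * θ - φ) * X

      0≤out : 0# ≤ φ * X
      0≤out = *-nonNegative 0≤φ (<⇒≤ 0<X)

      out≤half : φ * X ≤ half
      out≤half = *-monoʳ-≤ 0<X φ≤θ

      0≤half : 0# ≤ half
      0≤half = <⇒≤ (*-positive 0<θ 0<X)

      capturedAt : ∀ u → 0# ≤ u → u ≤ 2# * half → excursion (chosen I k) u ≡ onArc (chosen I k) φ →
                   ρ ≤ radius (position i (start k + u)) → radius (position i (start k + u)) ≤ X + r →
                   CapturedBy (ConCaC I) (start (suc k)) i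
      capturedAt u 0≤u u≤ at ρ≤ ≤X+r =
        start k + u ,
        subst (start k + u ≤_) (sym (start-suc k)) (+-mono-≤ ≤-refl u≤) ,
        contact (ConCaC I) i (start k + u)
          (≤-trans τ≤ (≤-via (solve 2 (λ s u → s :+ u :- s := u :- :0) refl (start k) u) 0≤u))
          ρ≤ ≤X+r (trans (ConCaC-epoch I k 0≤u u≤) (trans at arc))

      decide : radius (position i (start k + φ * X)) ≤ X + r ⊎
                 X + r < radius (position i (start k + φ * X)) →
               CapturedBy (ConCaC I) (start (suc k)) i
      decide (inj₁ near) = capturedAt (φ * X) 0≤out
        (≤-via (solve 2 (λ h o → :2 :* h :- o := (h :+ h) :- (o :+ :0)) refl half (φ * X))
          (+-mono-≤ out≤half 0≤half))
        (excursion-out (chosen I k) φ≤θ)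
        (subst (ρ ≤_) (sym (radius-later i (start k) (φ * X))) (≤-via
          (solve 5 (λ ρ φ x v y → (y :- v :* (φ :* x)) :- ρ := y :- (ρ :+ φ :* x :* v)) refl ρ φ X v y)
          (<⇒≤ lower)))
        near
      decide (inj₂ far) = capturedAt back
        (≤-via (solve 3 (λ θ φ x → (:2 :* θ :- φ) :* x :- :0 := (θ :* x :+ θ :* x) :- (φ :* x :+ :0))
            refl θ φ X)
          (+-mono-≤ out≤half 0≤half))
        (≤-via (solve 3 (λ θ φ x → :2 :* (θ :* x) :- (:2 :* θ :- φ) :* x := φ :* x :- :0) refl θ φ X)
          0≤out)
        (excursion-back (chosen I k) φ≤θ)
        -- Between the two passes the intruder descends by `2# * (θ - φ) * X * v`, at most
        -- `2# * θ * v * X`; starting above `X + r`, it stays at or above `ρ` by `ρ-r≤`.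
        (subst (ρ ≤_) (sym (radius-later i (start k) back)) (≤-via
          (solve 7 (λ ρ r θ φ x v y →
              (y :- v :* ((:2 :* θ :- φ) :* x)) :- ρ
              := ((y :- v :* (φ :* x)) :+ x :* (:1 :- :2 :* θ :* v) :+ (φ :* (x :* v) :+ φ :* (x :* v)))
                 :- ((x :+ r) :+ (ρ :- r) :+ (:0 :+ :0))) refl ρ r θ φ X v y)
          (+-mono-≤ (+-mono-≤ (subst (X + r ≤_) (radius-later i (start k) (φ * X)) (<⇒≤ far)) ρ-r≤)
            (+-mono-≤ 0≤φXv 0≤φXv))))
        (subst (_≤ X + r) (sym (radius-later i (start k) back)) (≤-via
          (solve 6 (λ r θ φ x v y →
              (x :+ r) :- (y :- v :* ((:2 :* θ :- φ) :* x)) := (x :+ r :+ (:2 :* θ :- φ) :* v :* x) :- y)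
            refl r θ φ X v y)
          (x≤y⊓z⇒x≤z 1# _ upper)))
        where
        0≤φXv : 0# ≤ φ * (X * v)
        0≤φXv = *-nonNegative 0≤φ (<⇒≤ 0<Xv)

    -- Every intruder is in its band at the start of some epoch.

    module _ {φ : ℝ} (0≤φ : 0# ≤ φ) (φ≤θ : φ ≤ θ) where

      0≤[θ-φ]Xv : 0# ≤ (θ - φ) * (X * v)
      0≤[θ-φ]Xv = *-nonNegative (0≤-diff φ≤θ) (<⇒≤ 0<Xv)

      upper-bound : ℝ
      upper-bound = 1# ⊓ (X + r + (2# * θ - φ) * v * X)

      -- The band is at least as long as the path of an intruder during an
      -- epoch, so that no intruder jumps over it.
      band-length : ρ + φ * X * v + v * (2# * half) ≤ upper-bound
      band-length = ⊓-glb
        -- Adding `≤1-r` and `ρ-r≤` yields `ρ + 3# * θ * v * X ≤ 1#`, the claim for the extreme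
        -- angle `φ = θ`.
        (≤-via (solve 6 (λ ρ r θ φ x v →
            :1 :- (ρ :+ φ :* x :* v :+ v :* (:2 :* (θ :* x)))
            := (:1 :- r :+ x :* (:1 :- :2 :* θ :* v) :+ (θ :- φ) :* (x :* v))
               :- (x :* (:1 :+ v :* θ) :+ (ρ :- r) :+ :0)) refl ρ r θ φ X v)
          (+-mono-≤ (+-mono-≤ ≤1-r ρ-r≤) 0≤[θ-φ]Xv))
        (≤-via (solve 6 (λ ρ r θ φ x v →
            (x :+ r :+ (:2 :* θ :- φ) :* v :* x) :- (ρ :+ φ :* x :* v :+ v :* (:2 :* (θ :* x)))
            := (x :* (:1 :- :2 :* θ :* v) :+ ((θ :- φ) :* (x :* v) :+ (θ :- φ) :* (x :* v)))
               :- ((ρ :- r) :+ (:0 :+ :0))) refl ρ r θ φ X v)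
          (+-mono-≤ ρ-r≤ (+-mono-≤ 0≤[θ-φ]Xv 0≤[θ-φ]Xv)))

      -- The right side, to which the initial wait is tuned, is the upper edge on the axis. It is at
      -- least the upper edge at `φ`, which `band-length` puts strictly above the lower one.
      initial-upper-bound : ρ + φ * X * v < 1# ⊓ (X + r + 2# * θ * v * X)
      initial-upper-bound = <-≤-trans
        (<-via (solve 3 (λ a v h → (a :+ v :* h) :- a := h :* v :- :0) refl (ρ + φ * X * v) v (2# * half))
          (*-positive 0<2half 0<v))
        (≤-trans band-length (⊓-glb (x≤y⊓z⇒x≤y 1# _ ≤-refl) (≤-trans (x≤y⊓z⇒x≤z 1# _ ≤-refl)
          (≤-via (solve 5 (λ r θ φ x v →
              (x :+ r :+ :2 :* θ :* v :* x) :- (x :+ r :+ (:2 :* θ :- φ) :* v :* x) := φ :* (x :* v) :- :0)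
              refl r θ φ X v)
            (*-nonNegative 0≤φ (<⇒≤ 0<Xv))))))

      -- Before its release an intruder has an extrapolated radius greater than `1#`.
      released : ∀ i t → radius (position i t) ≤ upper-bound → release i ≤ t
      released i t y≤ with ≤-or-> (release i) t
      ... | inj₁ τ≤t = τ≤t
      ... | inj₂ t<τ = contradiction (x≤y⊓z⇒x≤y 1# _ y≤) (<⇒≱ (<-via
        (solve 3 (λ v t τ → :1 :- v :* (t :- τ) :- :1 := v :* (τ :- t) :- :0) refl v t (release i))
        (*-positive 0<v (0<-diff t<τ))))

      enters-band : ∀ i → 0# ≤ release i →
                    ∃ λ k → release i ≤ start k × Band φ (radius (position i (start k)))
      enters-band i 0≤τ with archimedean 0<2half (start 0) (release i + (1# - upper-bound) / v)
      ... | n , late = result (first-occurrence (λ k → radius (position i (start k)) ≤ upper-bound) n below)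
        where
        below : radius (position i (start n)) ≤ upper-bound
        below = ≤-via
          (trans
            (solve 4 (λ U v s τ → U :- (:1 :- v :* (s :- τ)) := s :* v :- (τ :* v :+ (:1 :- U)))
              refl upper-bound v (start n) (release i))
            (cong (λ x → start n * v - (release i * v + x)) (sym (/-*-cancel 0<v (1# - upper-bound)))))
          (subst (_≤ start n * v)
            (solve 3 (λ τ q v → (τ :+ q) :* v := τ :* v :+ q :* v) refl (release i) ((1# - upper-bound) / v) v)
            (*-monoʳ-≤ 0<v (subst (release i + (1# - upper-bound) / v ≤_)
              (cong (_+ fromℕ n * (2# * half)) start-zero) late)))

        result : radius (position i (start 0)) ≤ upper-bound ⊎
                 (∃ λ j → ¬ radius (position i (start j)) ≤ upper-bound ×
                          radius (position i (start (suc j))) ≤ upper-bound) →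
                 ∃ λ k → release i ≤ start k × Band φ (radius (position i (start k)))
        result (inj₁ y≤) = 0 , released i (start 0) y≤ , <-≤-trans initial-upper-bound M≤y , y≤
          where
          M = 1# ⊓ (X + r + 2# * θ * v * X)

          -- The wait lasts `1# - M` and the speed is below `1#`, so an intruder released at or
          -- after time 0 has not descended past `M`.
          M≤y : M ≤ radius (position i (start 0))
          M≤y = subst (λ s → M ≤ 1# - v * (s - release i)) (sym start-zero) (≤-via
            (solve 3 (λ M v τ → :1 :- v :* (:1 :- M :- τ) :- M
                             := ((:1 :- v) :* (:1 :- M) :+ v :* τ) :- (:0 :+ :0)) refl M v (release i))
            (+-mono-≤
              (*-nonNegative (0≤-diff (<⇒≤ v<1)) (0≤-diff (x⊓y≤x 1# _)))
              (*-nonNegative (<⇒≤ 0<v) 0≤τ)))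
        -- The intruder was above the upper edge one epoch earlier and has descended by no more than
        -- the length of the band.
        result (inj₂ (j , above , y≤)) = suc j , released i (start (suc j)) y≤ ,
          subst (ρ + φ * X * v <_)
              (sym (trans (cong (radius ∘ position i) (start-suc j))
                (radius-later i (start j) (2# * half))))
            (<-via (solve 4 (λ a d y U → (y :- d) :- a := (y :+ U) :- (U :+ (a :+ d))) refl
                (ρ + φ * X * v) (v * (2# * half)) (radius (position i (start j))) upper-bound)
              (+-mono-<-≤ (≰⇒> above) band-length)) ,
          y≤

    -- Amortised counting over the epochs.

    InRegion : ℕ → Side → Intruder → Set
    InRegion k σ i = release i ≤ start k × Region σ (position i (start k))

    -- Capture is ignored: the formal position continues after it, so that every intruder is seen
    -- eventually.
    SeenBefore : ℕ → Intruder → Set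
    SeenBefore n i = ∃ λ k → k ℕ.< n × ∃ λ σ → InRegion k σ i

    eventually-seen : ∀ i → 0# ≤ release i → - θ ≤ direction i × direction i ≤ θ →
                      ∃ λ n → SeenBefore n i
    eventually-seen i 0≤τ (-θ≤β , β≤θ) =
      let φ , 0≤φ , φ≤θ , toRegion = band⇒region -θ≤β β≤θ
          k , τ≤ , band            = enters-band 0≤φ φ≤θ i 0≤τ
      in suc k , k , ℕ.n<1+n k , proj₁ (toRegion band) , τ≤ , proj₂ (toRegion band)

    SeenBefore-mono : ∀ {m n} i → m ℕ.≤ n → SeenBefore m i → SeenBefore n i
    SeenBefore-mono i m≤n (k , k<m , s) = k , ℕ.<-≤-trans k<m m≤n , s

    all-eventually-seen : ∀ {xs} → All (λ i → ∃ λ n → SeenBefore n i) xs → ∃ λ n → All (SeenBefore n) xs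
    all-eventually-seen [] = 0 , []
    all-eventually-seen (_∷_ {i} (m , s) ss) with all-eventually-seen ss
    ... | n , seen = m ℕ.⊔ n , SeenBefore-mono i (ℕ.m≤m⊔n m n) s ∷
      All.map (λ {j} → SeenBefore-mono j (ℕ.m≤n⊔m m n)) seen

    module _ (I : Instance) where

      xs = intruders I

      CapturedIn : ℕ → Intruder → Set
      CapturedIn k = CapturedBy (ConCaC I) (start k)

      -- Sightings at the starts of epochs below `k` are set against captures up to `start k`, when
      -- the last of those epochs is over.
      SeenUncaptured : ℕ → Intruder → Set
      SeenUncaptured k i = SeenBefore k i × ¬ CapturedIn k i

      Waiting : ℕ → Side → Intruder → Set
      Waiting k σ i = Present (firstEpochs I k) (start k) i × Region σ (position i (start k))

      -- A tie sends the vehicle left, so the inequality is weak in one case; the pairing of escapes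
      -- with captures requires no more.
      choose-majority : ∀ p t →
        number (Region (opposite (choose I p t))) I p t ℕ.≤ number (Region (choose I p t)) I p t
      choose-majority p t with number Sleft I p t ℕ.<? number Sright I p t
      ... | yes l<r = ℕ.<⇒≤ l<r
      ... | no  l≮r = ℕ.≮⇒≥ l≮r

      -- Presence at `start k` excludes earlier capture, so no intruder pays in two epochs.
      newly-captured : ∀ k → count (CapturedIn k) xs ℕ.+ count (Waiting k (chosen I k)) xs
                             ℕ.≤ count (CapturedIn (suc k)) xs
      newly-captured k = count-disjoint
        (λ i → CapturedBy-mono i (start-mono k))
        (λ i ((τ≤ , _) , region) → capture I k i τ≤ region)
        (λ i c ((_ , ¬c) , _) → ¬c (CapturedBy-ConCaC I k i c))
        xs

      newly-uncaptured : ∀ k → count (SeenUncaptured (suc k)) xs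
                               ℕ.≤ count (SeenUncaptured k) xs ℕ.+ count (Waiting k (opposite (chosen I k))) xs
      newly-uncaptured k = count-cover cover xs
        where
        cover : ∀ i → SeenUncaptured (suc k) i → SeenUncaptured k i ⊎ Waiting k (opposite (chosen I k)) i
        cover i ((j , j<1+k , σ , τ≤ , region) , ¬c) with ℕ.m<1+n⇒m<n∨m≡n j<1+k
        ... | inj₁ j<k  = inj₁ ((j , j<k , σ , τ≤ , region) , ¬c ∘ CapturedBy-mono i (start-mono k))
        -- An intruder first accounted for at epoch `k` cannot be on the chosen side, since
        -- `capture` would apply to it.
        ... | inj₂ refl with same-or-opposite (chosen I k) σ
        ... | inj₁ refl = contradiction (capture I k i τ≤ region) ¬c
        ... | inj₂ refl = inj₂
          ((τ≤ , ¬c ∘ CapturedBy-mono i (start-mono k) ∘ CapturedBy-firstEpochs I k i) , region)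

      uncaptured≤captured : ∀ k → count (SeenUncaptured k) xs ℕ.≤ count (CapturedIn k) xs
      uncaptured≤captured zero    = count-mono (λ { i ((_ , () , _) , _) }) xs
      uncaptured≤captured (suc k) = begin
        count (SeenUncaptured (suc k)) xs
          ≤⟨ newly-uncaptured k ⟩
        count (SeenUncaptured k) xs ℕ.+ count (Waiting k (opposite (chosen I k))) xs
          ≤⟨ ℕ.+-mono-≤ (uncaptured≤captured k) (choose-majority (firstEpochs I k) (start k)) ⟩
        count (CapturedIn k) xs ℕ.+ count (Waiting k (chosen I k)) xs
          ≤⟨ newly-captured k ⟩
        count (CapturedIn (suc k)) xs ∎
        where open ℕ.≤-Reasoning hiding (start)

      half-captured-if-seen : ∀ n → All (SeenBefore n) xs →
                              length xs ℕ.≤ captures I (ConCaC I) ℕ.+ captures I (ConCaC I)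
      half-captured-if-seen n seen = begin
        length xs                                                      ≡⟨ count-all seen ⟩
        count (SeenBefore n) xs                                        ≤⟨ count-cover split xs ⟩
        count (CapturedIn n) xs ℕ.+ count (SeenUncaptured n) xs        ≤⟨ ℕ.+-monoʳ-≤ _ (uncaptured≤captured n) ⟩
        count (CapturedIn n) xs ℕ.+ count (CapturedIn n) xs            ≤⟨ ℕ.+-mono-≤ captured captured ⟩
        captures I (ConCaC I) ℕ.+ captures I (ConCaC I)                ∎
        where
        open ℕ.≤-Reasoning hiding (start)

        captured : count (CapturedIn n) xs ℕ.≤ captures I (ConCaC I)
        captured = count-mono (λ i (s , _ , c) → s , c) xs

        split : ∀ i → SeenBefore n i → CapturedIn n i ⊎ SeenUncaptured n i
        split i s with em {CapturedIn n i}
        ... | yes c = inj₁ c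
        ... | no ¬c = inj₂ (s , ¬c)

      half-captured : length xs ℕ.≤ captures I (ConCaC I) ℕ.+ captures I (ConCaC I)
      half-captured =
        let n , seen = all-eventually-seen (All.zipWith
              (λ {i} ((0≤τ , _) , dir) → eventually-seen i 0≤τ dir) (times I , directions I))
        in half-captured-if-seen n seen

    -- The optimum is bounded by the total number of intruders, the cap built into `greatest`; half
    -- of that total is already captured.
    ConCaC-competitive : Competitive 2# ConCaC
    ConCaC-competitive I = ≤-trans
      (fromℕ-mono (ℕ.≤-trans (greatest≤ _ (length (intruders I))) (half-captured I)))
      (≤-reflexive (trans (fromℕ-+ n n) (solve 1 (λ x → x :+ x := :2 :* x) refl (fromℕ n))))
      where n = captures I (ConCaC I)

-- Clearing the denominators of the hypotheses.

mainTheorem4 :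
    (em : ExcludedMiddle 0ℓ) (ℜ : CompleteOrderedField) →
    let open CompleteOrderedField ℜ
        open PerimeterDefense em ℜ in
    (𝒫 : Problem) →
    let open Problem 𝒫
        open Game 𝒫 in
    v ≤ (r / (θ * (ρ + r))) ⊓ ((1# - ρ) / (θ * (2# - 3# * r + ρ))) →
    (x-C : Carrier) →
    (ρ - r) / (1# - 2# * θ * v) ≤ x-C →
    x-C ≤ (ρ + r) ⊓ ((1# - r) / (1# + v * θ)) →
    Competitive 2# (ConCaC x-C)
mainTheorem4 em ℜ 𝒫 v≤ X X≥ X≤ =
  ConCaCAnalysis.Guarantee.ConCaC-competitive em ℜ 𝒫 X
    (<-≤-trans (*-positive (0<-diff r<ρ) (⁻¹-positive 0<1-2θv)) X≥)
    (y/x≤z⇒y≤z*x 0<1-2θv X≥)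
    (x≤y⊓z⇒x≤y (ρ + r) _ X≤)
    (y≤z/x⇒y*x≤z 0<1+vθ (x≤y⊓z⇒x≤z (ρ + r) _ X≤))
  where
  open CompleteOrderedField ℜ
  open OrderedField em ℜ
  open PerimeterDefense em ℜ
  open Problem 𝒫

  0<ρ+r : 0# < ρ + r
  0<ρ+r = <-≤-trans 0<r (≤-via (solve 2 (λ ρ r → (ρ :+ r) :- r := ρ :- :0) refl ρ r) (<⇒≤ 0<ρ))

  v[θ[ρ+r]]≤r : v * (θ * (ρ + r)) ≤ r
  v[θ[ρ+r]]≤r = y≤z/x⇒y*x≤z (*-positive 0<θ 0<ρ+r) (x≤y⊓z⇒x≤y _ _ v≤)

  -- Doubling `v[θ[ρ+r]]≤r` bounds `2# * θ * v * (ρ + r)` by `r + r`, which is less than `ρ + r`.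
  0<1-2θv : 0# < 1# - 2# * θ * v
  0<1-2θv = ≰⇒> λ 1-2θv≤0 → <⇒≱ r<ρ (≤-via
    (solve 4 (λ ρ r θ v → r :- ρ
                       := (r :+ r :+ :0 :* (ρ :+ r))
                          :- (v :* (θ :* (ρ :+ r)) :+ v :* (θ :* (ρ :+ r)) :+ (:1 :- :2 :* θ :* v) :* (ρ :+ r)))
      refl ρ r θ v)
    (+-mono-≤ (+-mono-≤ v[θ[ρ+r]]≤r v[θ[ρ+r]]≤r) (*-monoʳ-≤ 0<ρ+r 1-2θv≤0)))

  0<1+vθ : 0# < 1# + v * θ
  0<1+vθ = <-≤-trans 0<1 (≤-via (solve 2 (λ v θ → (:1 :+ v :* θ) :- :1 := v :* θ :- :0) refl v θ)
    (<⇒≤ (*-positive 0<v 0<θ)))
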